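{- Let $G$ be a $2$-uniform linear oriented hypergraph (that is, a simple oriented signed graph) with maximum degree $\Delta(G)$. Then for every integer $k\ge\Delta(G)$ there exists a $k$-uniform linear oriented hypergraph $H_k$ with $\Lambda(H_k)=G$.
   Context: A hypergraph $(V,E,\mathcal I)$ consists of a finite set $V$ of vertices, a finite family $E=(e_\iota)_{\iota\in\Omega}$ of subsets of $V$ (the edges; an edge may be empty, and edges with different indices are regarded as different even if they coincide as sets) and its incidences $\mathcal I$. All hypergraphs are simple: each vertex $v\in e$ is incident with $e$ exactly once, so $\mathcal I=\{(v,e): v\in e\}$. A hypergraph is linear if $|e\cap f|\le 1$ for any two edges $e,f$ with distinct indices; it is $k$-uniform if every edge has exactly $k$ elements. The degree of a vertex is the number of edges containing it, and $\Delta$ is the maximum vertex degree. An oriented hypergraph is a hypergraph together with a map $\sigma:\mathcal I\to\{+1,-1\}$; hypergraph terminology for an oriented hypergraph refers to its underlying hypergraph. Intersection graph: for a linear oriented hypergraph $G$, $\Lambda(G)$ is the oriented hypergraph with vertex set $E(G)$ and one edge $ef=\{e,f\}$ for each pair of distinct $e,f\in E(G)$ with $e\cap f\ne\varnothing$; if $v\in e\cap f$ then $\sigma_{\Lambda(G)}(e,ef)=\sigma_G(v,e)$ and $\sigma_{\Lambda(G)}(f,ef)=\sigma_G(v,f)$. Equality of oriented hypergraphs means: same vertex set, and edge families that agree up to a bijective renaming of edges preserving the vertex sets of the edges and the orientation of each incidence. -}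

module Defs where

open import Data.Fin using (Fin; _<_; _<?_)
open import Data.Fin.Subset using (Subset; _∈_; _∩_; _∪_; ⁅_⁆; ∣_∣; Nonempty)
open import Data.Fin.Subset.Properties using (nonempty?; x∈p∩q⁻; x∈p∪q⁻; x∈⁅y⁆⇒x≡y)
open import Data.List using (List; allFin; cartesianProduct; filter; length; lookup; map)
open import Data.List.Extrema.Nat using (max)
open import Data.List.Membership.Propositional.Properties using (∈-lookup)
open import Data.List.Relation.Unary.All as All using ()
open import Data.List.Relation.Unary.All.Properties using (all-filter)
open import Data.Nat using (ℕ; _≤_)
open import Data.Product using (Σ; _×_; _,_; proj₁; proj₂; Σ-syntax)
open import Data.Sign using (Sign)
open import Data.Sum using ([_,_])
import Data.Vec as Vec
open import Function using (_↔_; Inverse)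
open import Relation.Binary.PropositionalEquality using (_≡_; _≢_; sym; subst)
open import Relation.Nullary using (Dec; _×-dec_)

private
  variable
    n m m′ : ℕ

-- Vertex set Fin n; the edges form a family indexed by Fin m, so edges may be
-- empty, and edges with different indices may coincide as sets.
record Hypergraph (n m : ℕ) : Set where
  field
    edge : Fin m → Subset n

  Incidence : Set
  Incidence = Σ[ (v , e) ∈ Fin n × Fin m ] v ∈ edge e

  edgesAt : Fin n → Subset m
  edgesAt v = Vec.tabulate λ e → Vec.lookup (edge e) v

  degree : Fin n → ℕ
  degree v = ∣ edgesAt v ∣

  -- This is 0 when there are no vertices.
  maxDegree : ℕ
  maxDegree = max 0 (map degree (allFin n))

  Linear : Set
  Linear = ∀ e f → e ≢ f → ∣ edge e ∩ edge f ∣ ≤ 1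

  Uniform : ℕ → Set
  Uniform k = ∀ e → ∣ edge e ∣ ≡ k

record OrientedHypergraph (n m : ℕ) : Set where
  field
    hypergraph : Hypergraph n m
  open Hypergraph hypergraph public
  field
    σ : Incidence → Sign

-- Equality of oriented hypergraphs on the same vertex set Fin n.
record _≈_ (G : OrientedHypergraph n m) (H : OrientedHypergraph n m′) : Set where
  private
    module G = OrientedHypergraph G
    module H = OrientedHypergraph H
  field
    rename : Fin m ↔ Fin m′
  open Inverse rename using (to)
  field
    sameVertices    : ∀ e → G.edge e ≡ H.edge (to e)
    sameOrientation : ∀ v e (p : v ∈ G.edge e) (q : v ∈ H.edge (to e)) →
                      G.σ ((v , e) , p) ≡ H.σ ((v , to e) , q)

infix 4 _≈_

module IntersectionGraph (G : OrientedHypergraph n m) where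
  open OrientedHypergraph G

  -- An unordered pair of distinct edges is represented by the ordered pair of
  -- its indices with the smaller index first.
  Meet : Fin m × Fin m → Set
  Meet (e , f) = e < f × Nonempty (edge e ∩ edge f)

  meet? : ∀ ef → Dec (Meet ef)
  meet? (e , f) = e <? f ×-dec nonempty? (edge e ∩ edge f)

  meetingPairs : List (Fin m × Fin m)
  meetingPairs = filter meet? (cartesianProduct (allFin m) (allFin m))

  size : ℕ
  size = length meetingPairs

  pair : Fin size → Fin m × Fin m
  pair = lookup meetingPairs

  pair-meets : ∀ i → Meet (pair i)
  pair-meets i =
    All.lookup (all-filter meet? (cartesianProduct (allFin m) (allFin m))) (∈-lookup i)

  endpoints : Fin size → Subset m
  endpoints i = ⁅ proj₁ (pair i) ⁆ ∪ ⁅ proj₂ (pair i) ⁆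

  common : Fin size → Fin n
  common i = proj₁ (proj₂ (pair-meets i))

  common∈ : ∀ i {x} → x ∈ endpoints i → common i ∈ edge x
  common∈ i {x} x∈ =
    [ (λ p → transport (x∈⁅y⁆⇒x≡y e p) v∈e)
    , (λ p → transport (x∈⁅y⁆⇒x≡y f p) v∈f)
    ] (x∈p∪q⁻ ⁅ e ⁆ ⁅ f ⁆ x∈)
    where
    e f : Fin m
    e = proj₁ (pair i)
    f = proj₂ (pair i)
    v∈e : common i ∈ edge e
    v∈e = proj₁ (x∈p∩q⁻ (edge e) (edge f) (proj₂ (proj₂ (pair-meets i))))
    v∈f : common i ∈ edge f
    v∈f = proj₂ (x∈p∩q⁻ (edge e) (edge f) (proj₂ (proj₂ (pair-meets i))))
    transport : ∀ {y} → x ≡ y → common i ∈ edge y → common i ∈ edge x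
    transport x≡y = subst (λ z → common i ∈ edge z) (sym x≡y)

-- The vertex set of Λ G is the index set of the edges of G.  Linearity makes
-- the common vertex of two meeting edges unique, so taking the one found by
-- the search in meet? involves no choice.
Λ : (G : OrientedHypergraph n m) → OrientedHypergraph.Linear G →
    OrientedHypergraph m (IntersectionGraph.size G)
Λ G _ = record
  { hypergraph = record { edge = endpoints }
  ; σ = λ { ((x , i) , x∈i) → σ ((common i , x) , common∈ i x∈i) }
  }
  where
  open OrientedHypergraph G
  open IntersectionGraph G

{-# OPTIONS --safe #-}
module Submission where

-- Take the dual of G: its vertices are the edges of G, and its edge v consists
-- of the edges of G at v.  Enlarge this edge by k - degree v new vertices of
-- its own to make the dual k-uniform.  New vertices lie in one edge only, so
-- two edges v and w of the result meet exactly in the edges of G containing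
-- both v and w.  Linearity of G leaves at most one such edge, and since edges
-- of G are pairs, every edge of G arises from exactly one pair v, w.

open import Defs
open import Data.Fin using (Fin; zero; suc; _<_; _↑ˡ_; splitAt; join)
open import Data.Fin.Properties using (_≟_; <-asym; <⇒≢; join-splitAt)
open import Data.Fin.Subset
  using (Subset; inside; outside; _∈_; _∩_; _∪_; ⁅_⁆; ∣_∣; ⊥; ⊤; _-_)
open import Data.Fin.Subset.Properties
open import Data.List using (List; lookup)
open import Data.List.Extrema.Nat using (xs≤max)
import Data.List.Membership.Propositional as List
open import Data.List.Membership.Propositional.Properties
  using (∈-lookup; ∈-allFin; ∈-map⁺; ∈-filter⁺; ∈-cartesianProduct⁺)
open import Data.List.Relation.Unary.All as All using ()
open import Data.List.Relation.Unary.AllPairs using (_∷_)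
open import Data.List.Relation.Unary.Any using (index)
open import Data.List.Relation.Unary.Any.Properties using (lookup-index)
open import Data.List.Relation.Unary.Unique.Propositional using (Unique)
import Data.List.Relation.Unary.Unique.Propositional.Properties as Unique
open import Data.Nat using (ℕ; zero; suc; _+_; _∸_; _≤_; z≤n; s≤s)
open import Data.Nat.Properties
  using (≤-trans; ≤-reflexive; ≤⇒≯; suc-injective; +-identityʳ; m+[n∸m]≡n)
open import Data.Product using (_×_; _,_; proj₁; proj₂; Σ-syntax; ∃-syntax)
open import Data.Sign using (Sign)
open import Data.Sum as Sum using (inj₁; inj₂; [_,_]′)
open import Data.Vec using (_∷_; []; _++_; here; there; sum; tabulate)
open import Data.Vec.Properties using ([]=⇒lookup; lookup⇒[]=; lookup∘tabulate)
open import Data.Vec.Properties.WithK using ([]=-irrelevant)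
open import Function using (_∘_; const; mk⤖)
open import Function.Consequences.Propositional using (strictlySurjective⇒surjective)
open import Function.Properties.Bijection using (⤖⇒↔)
open import Relation.Binary.PropositionalEquality
open import Relation.Nullary using (yes; no; contradiction)

private
  variable
    m n : ℕ

-- Duplicate-free lists and subsets with at most two elements.

lookup-injective : ∀ {a} {A : Set a} {xs : List A} → Unique xs →
                   ∀ i j → lookup xs i ≡ lookup xs j → i ≡ j
lookup-injective (_ ∷ _)    zero    zero    _  = refl
lookup-injective (x∉xs ∷ _) zero    (suc j) eq = contradiction eq (All.lookup x∉xs (∈-lookup j))
lookup-injective (x∉xs ∷ _) (suc i) zero    eq = contradiction (sym eq) (All.lookup x∉xs (∈-lookup i))
lookup-injective (_ ∷ xs!)  (suc i) (suc j) eq = cong suc (lookup-injective xs! i j eq)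

∣p∣≤1⇒x≡y : ∀ {p : Subset n} {x y} → ∣ p ∣ ≤ 1 → x ∈ p → y ∈ p → x ≡ y
∣p∣≤1⇒x≡y {p = p} {x} {y} ∣p∣≤1 x∈p y∈p with x ≟ y
... | yes x≡y = x≡y
... | no  x≢y = contradiction (s≤s 1≤∣p-x∣) (≤⇒≯ (≤-trans (x∈p⇒∣p-x∣<∣p∣ x∈p) ∣p∣≤1))
  where
  ⁅y⁆⊆p-x : ∀ {z} → z ∈ ⁅ y ⁆ → z ∈ p - x
  ⁅y⁆⊆p-x z∈⁅y⁆ rewrite x∈⁅y⁆⇒x≡y y z∈⁅y⁆ = x∈p∧x≢y⇒x∈p-y y∈p (x≢y ∘ sym)
  1≤∣p-x∣ : 1 ≤ ∣ p - x ∣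
  1≤∣p-x∣ = ≤-trans (≤-reflexive (sym (∣⁅x⁆∣≡1 y))) (p⊆q⇒∣p∣≤∣q∣ ⁅y⁆⊆p-x)

x≡y⇒∣p∣≤1 : ∀ (p : Subset n) → (∀ {x y} → x ∈ p → y ∈ p → x ≡ y) → ∣ p ∣ ≤ 1
x≡y⇒∣p∣≤1 {n} p h with nonempty? p
... | yes (x , x∈p) = ≤-trans (p⊆q⇒∣p∣≤∣q∣ λ y∈p → subst (_∈ ⁅ x ⁆) (h x∈p y∈p) (x∈⁅x⁆ x))
                              (≤-reflexive (∣⁅x⁆∣≡1 x))
... | no  p-empty         =
  subst (_≤ 1) (sym (trans (cong ∣_∣ (Empty-unique p-empty)) (∣⊥∣≡0 n))) z≤n

∣p∣≡0⇒p≡⊥ : ∀ (p : Subset n) → ∣ p ∣ ≡ 0 → p ≡ ⊥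
∣p∣≡0⇒p≡⊥ []            _  = refl
∣p∣≡0⇒p≡⊥ (outside ∷ p) eq = cong (outside ∷_) (∣p∣≡0⇒p≡⊥ p eq)

∣p∣≡1⇒p≡⁅x⁆ : ∀ (p : Subset n) → ∣ p ∣ ≡ 1 → ∃[ x ] p ≡ ⁅ x ⁆
∣p∣≡1⇒p≡⁅x⁆ (inside  ∷ p) eq = zero , cong (inside ∷_) (∣p∣≡0⇒p≡⊥ p (suc-injective eq))
∣p∣≡1⇒p≡⁅x⁆ (outside ∷ p) eq with x , p≡⁅x⁆ ← ∣p∣≡1⇒p≡⁅x⁆ p eq = suc x , cong (outside ∷_) p≡⁅x⁆

∣p∣≡2⇒p≡⁅x⁆∪⁅y⁆ : ∀ (p : Subset n) → ∣ p ∣ ≡ 2 →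
                   ∃[ x ] ∃[ y ] (x < y × p ≡ ⁅ x ⁆ ∪ ⁅ y ⁆)
∣p∣≡2⇒p≡⁅x⁆∪⁅y⁆ (inside  ∷ p) eq with y , p≡⁅y⁆ ← ∣p∣≡1⇒p≡⁅x⁆ p (suc-injective eq) =
  zero , suc y , s≤s z≤n , cong (inside ∷_) (trans p≡⁅y⁆ (sym (∪-identityˡ ⁅ y ⁆)))
∣p∣≡2⇒p≡⁅x⁆∪⁅y⁆ (outside ∷ p) eq with x , y , x<y , p≡ ← ∣p∣≡2⇒p≡⁅x⁆∪⁅y⁆ p eq =
  suc x , suc y , s≤s x<y , cong (outside ∷_) p≡

-- Meeting pairs are listed with the smaller index first, and this lets the set of endpoints
-- determine the pair. Of the four placements of `x′` and `y′`, two make them equal and one reverses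
-- their order.
ordered-pair-unique : ∀ {x y x′ y′ : Fin n} → x < y → x′ < y′ →
                      x′ ∈ ⁅ x ⁆ ∪ ⁅ y ⁆ → y′ ∈ ⁅ x ⁆ ∪ ⁅ y ⁆ → (x′ , y′) ≡ (x , y)
ordered-pair-unique {x = x} {y} x<y x′<y′ x′∈ y′∈
  with Sum.map (x∈⁅y⁆⇒x≡y x) (x∈⁅y⁆⇒x≡y y) (x∈p∪q⁻ _ _ x′∈)
     | Sum.map (x∈⁅y⁆⇒x≡y x) (x∈⁅y⁆⇒x≡y y) (x∈p∪q⁻ _ _ y′∈)
... | inj₁ refl | inj₁ refl = contradiction refl (<⇒≢ x′<y′)
... | inj₁ refl | inj₂ refl = refl
... | inj₂ refl | inj₁ refl = contradiction x<y (<-asym x′<y′)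
... | inj₂ refl | inj₂ refl = contradiction refl (<⇒≢ x′<y′)

-- Concatenated subsets and disjoint blocks.

∣p++q∣≡∣p∣+∣q∣ : ∀ (p : Subset m) (q : Subset n) → ∣ p ++ q ∣ ≡ ∣ p ∣ + ∣ q ∣
∣p++q∣≡∣p∣+∣q∣ []            q = refl
∣p++q∣≡∣p∣+∣q∣ (inside  ∷ p) q = cong suc (∣p++q∣≡∣p∣+∣q∣ p q)
∣p++q∣≡∣p∣+∣q∣ (outside ∷ p) q = ∣p++q∣≡∣p∣+∣q∣ p q

-- Phrasing membership as a branch over `splitAt` lets one case split on the position of `x` settle
-- several concatenations at once.
x∈p++q⁻ : ∀ (p : Subset m) (q : Subset n) {x} → x ∈ p ++ q → [ _∈ p , _∈ q ]′ (splitAt m x)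
x∈p++q⁻ []      q x∈q  = x∈q
x∈p++q⁻ (_ ∷ p) q here = here
x∈p++q⁻ {m = suc m} (_ ∷ p) q {suc x} (there x∈) with splitAt m x | x∈p++q⁻ p q x∈
... | inj₁ _ | x∈p = there x∈p
... | inj₂ _ | x∈q = x∈q

x∈p⇒x↑ˡ∈p++q : ∀ {p : Subset m} {q : Subset n} {x} → x ∈ p → (x ↑ˡ n) ∈ p ++ q
x∈p⇒x↑ˡ∈p++q here        = here
x∈p⇒x↑ˡ∈p++q (there x∈p) = there (x∈p⇒x↑ˡ∈p++q x∈p)

-- The positions are cut into consecutive intervals with lengths given by `d`; each index owns one
-- interval.
block : ∀ (d : Fin n → ℕ) → Fin n → Subset (sum (tabulate d))
block d zero    = ⊤ {d zero} ++ ⊥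
block d (suc v) = ⊥ {d zero} ++ block (d ∘ suc) v

∣block∣ : ∀ (d : Fin n → ℕ) v → ∣ block d v ∣ ≡ d v
∣block∣ d zero = begin
  ∣ block d zero ∣               ≡⟨ ∣p++q∣≡∣p∣+∣q∣ (⊤ {d zero}) ⊥ ⟩
  ∣ ⊤ {d zero} ∣ + ∣ ⊥ {rest} ∣  ≡⟨ cong₂ _+_ (∣⊤∣≡n (d zero)) (∣⊥∣≡0 rest) ⟩
  d zero + 0                     ≡⟨ +-identityʳ (d zero) ⟩
  d zero                         ∎
  where
  open ≡-Reasoning
  rest = sum (tabulate (d ∘ suc))
∣block∣ d (suc v) = begin
  ∣ block d (suc v) ∣                        ≡⟨ ∣p++q∣≡∣p∣+∣q∣ (⊥ {d zero}) _ ⟩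
  ∣ ⊥ {d zero} ∣ + ∣ block (d ∘ suc) v ∣     ≡⟨ cong₂ _+_ (∣⊥∣≡0 (d zero)) (∣block∣ (d ∘ suc) v) ⟩
  d (suc v)                                  ∎
  where open ≡-Reasoning

-- Over the first `d zero` positions only the block of `zero` can have elements. Past them that
-- block is empty, and induction compares the others.
block-disjoint : ∀ (d : Fin n → ℕ) {v w x} → x ∈ block d v → x ∈ block d w → v ≡ w
block-disjoint d {zero} {zero} _ _ = refl
block-disjoint d {zero} {suc w} {x} x∈v x∈w
  with splitAt (d zero) x
     | x∈p++q⁻ (⊤ {d zero}) ⊥ x∈v
     | x∈p++q⁻ (⊥ {d zero}) (block (d ∘ suc) w) x∈w
... | inj₁ _ | _   | x∈⊥ = contradiction x∈⊥ ∉⊥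
... | inj₂ _ | x∈⊥ | _   = contradiction x∈⊥ ∉⊥
block-disjoint d {suc v} {zero} x∈v x∈w = sym (block-disjoint d x∈w x∈v)
block-disjoint d {suc v} {suc w} {x} x∈v x∈w
  with splitAt (d zero) x
     | x∈p++q⁻ (⊥ {d zero}) (block (d ∘ suc) v) x∈v
     | x∈p++q⁻ (⊥ {d zero}) (block (d ∘ suc) w) x∈w
... | inj₁ _ | x∈⊥ | _   = contradiction x∈⊥ ∉⊥
... | inj₂ _ | y∈v | y∈w = cong suc (block-disjoint (d ∘ suc) y∈v y∈w)

-- The padded dual hypergraph.

module Dual (G : Hypergraph n m) where
  open Hypergraph G

  e∈edgesAt⁺ : ∀ {v e} → v ∈ edge e → e ∈ edgesAt v
  e∈edgesAt⁺ {v} {e} v∈e =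
    lookup⇒[]= e _ (trans (lookup∘tabulate _ e) ([]=⇒lookup v∈e))

  e∈edgesAt⁻ : ∀ {v e} → e ∈ edgesAt v → v ∈ edge e
  e∈edgesAt⁻ {v} {e} e∈ =
    lookup⇒[]= v _ (trans (sym (lookup∘tabulate _ e)) ([]=⇒lookup e∈))

  degree≤maxDegree : ∀ v → degree v ≤ maxDegree
  degree≤maxDegree v = All.lookup (xs≤max 0 _) (∈-map⁺ degree (∈-allFin v))

  module _ (k : ℕ) where
    deficiency : Fin n → ℕ
    deficiency v = k ∸ degree v

    order : ℕ
    order = m + sum (tabulate deficiency)

    paddedDual : Hypergraph order n
    paddedDual = record { edge = λ v → edgesAt v ++ block deficiency v }

    open Hypergraph paddedDual using ()
      renaming (edge to edge*; Linear to Linear*; Uniform to Uniform*)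

    -- Padding is never shared: a new vertex in both edges would lie in the blocks of `v` and of
    -- `w`. The result is an equation on `splitAt` because the orientation of `H` branches on that
    -- term.
    common-vertex : ∀ {v w x} → v ≢ w → x ∈ edge* v → x ∈ edge* w →
                    ∃[ e ] (splitAt m x ≡ inj₁ e × v ∈ edge e × w ∈ edge e)
    common-vertex {v} {w} {x} v≢w x∈v x∈w
      with splitAt m x | x∈p++q⁻ (edgesAt v) _ x∈v | x∈p++q⁻ (edgesAt w) _ x∈w
    ... | inj₁ e | e∈v | e∈w = e , refl , e∈edgesAt⁻ e∈v , e∈edgesAt⁻ e∈w
    ... | inj₂ _ | y∈v | y∈w = contradiction (block-disjoint deficiency y∈v y∈w) v≢w

    paddedDual-uniform : maxDegree ≤ k → Uniform* k
    paddedDual-uniform Δ≤k v = begin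
      ∣ edge* v ∣                            ≡⟨ ∣p++q∣≡∣p∣+∣q∣ (edgesAt v) _ ⟩
      degree v + ∣ block deficiency v ∣      ≡⟨ cong (degree v +_) (∣block∣ deficiency v) ⟩
      -- The bound `Δ≤k` makes the truncated subtraction in `deficiency` a true one.
      degree v + (k ∸ degree v)              ≡⟨ m+[n∸m]≡n (≤-trans (degree≤maxDegree v) Δ≤k) ⟩
      k                                      ∎
      where open ≡-Reasoning

    module _ (linear : Linear) where
      -- Distinct edges sharing `v` and `w` would have an intersection of size at least 2, against
      -- linearity.
      edges-meet-once : ∀ {v w e f} → v ≢ w → v ∈ edge e → w ∈ edge e →
                        v ∈ edge f → w ∈ edge f → e ≡ f
      edges-meet-once {e = e} {f} v≢w v∈e w∈e v∈f w∈f with e ≟ f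
      ... | yes e≡f = e≡f
      ... | no  e≢f = contradiction
        (∣p∣≤1⇒x≡y (linear e f e≢f) (x∈p∩q⁺ (v∈e , v∈f)) (x∈p∩q⁺ (w∈e , w∈f))) v≢w

      paddedDual-linear : Linear*
      paddedDual-linear v w v≢w = x≡y⇒∣p∣≤1 (edge* v ∩ edge* w) λ {x} {y} x∈ y∈ →
        let x∈v , x∈w = x∈p∩q⁻ (edge* v) (edge* w) x∈
            y∈v , y∈w = x∈p∩q⁻ (edge* v) (edge* w) y∈
            e , x≡e , v∈e , w∈e = common-vertex v≢w x∈v x∈w
            f , y≡f , v∈f , w∈f = common-vertex v≢w y∈v y∈w
            e≡f = edges-meet-once v≢w v∈e w∈e v∈f w∈f
        in splitAt-injective x y (trans x≡e (trans (cong inj₁ e≡f) (sym y≡f)))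
        where
        splitAt-injective : ∀ x y → splitAt m {sum (tabulate deficiency)} x ≡ splitAt m y → x ≡ y
        splitAt-injective x y eq =
          trans (sym (join-splitAt m _ x)) (trans (cong (join m _) eq) (join-splitAt m _ y))

-- The intersection graph of the oriented padded dual.

module _ (G : OrientedHypergraph n m) (2-uniform : OrientedHypergraph.Uniform G 2)
         (linear : OrientedHypergraph.Linear G) (k : ℕ) where
  open OrientedHypergraph G
  open Dual hypergraph

  -- The value + off the incidences of G is junk.
  extendedσ : Fin n → Fin m → Sign
  extendedσ v e with v ∈? edge e
  ... | yes v∈e = σ ((v , e) , v∈e)
  ... | no  _   = Sign.+

  extendedσ-σ : ∀ v e (v∈e : v ∈ edge e) → extendedσ v e ≡ σ ((v , e) , v∈e)
  extendedσ-σ v e v∈e with v ∈? edge e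
  -- The decision returns its own membership proof; proof irrelevance exchanges it for the given
  -- one.
  ... | yes v∈e′ = cong (λ p → σ ((v , e) , p)) ([]=-irrelevant v∈e′ v∈e)
  ... | no  v∉e  = contradiction v∈e v∉e

  H : OrientedHypergraph (order k) n
  H = record
    { hypergraph = paddedDual k
    -- An old vertex `e` of the edge `v` inherits the sign of `v` in `e`. New vertices get `+`, a
    -- default that never reaches the intersection graph, since common vertices of distinct edges
    -- are old.
    ; σ          = λ ((x , v) , _) → [ extendedσ v , const Sign.+ ]′ (splitAt m x)
    }
  open IntersectionGraph H

  originalEdge : ∀ i → let v , w = pair i in
                 ∃[ e ] (splitAt m (common i) ≡ inj₁ e × v ∈ edge e × w ∈ edge e)
  originalEdge i with v<w , x , x∈ ← pair-meets i =
    let x∈v , x∈w = x∈p∩q⁻ _ _ x∈ in common-vertex k (<⇒≢ v<w) x∈v x∈w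

  toEdge : Fin size → Fin m
  toEdge i = proj₁ (originalEdge i)

  -- `originalEdge` puts both entries of `pair i` into this two-element edge, and both pairs are
  -- increasing.
  pair-determined : ∀ i {v w} → v < w → edge (toEdge i) ≡ ⁅ v ⁆ ∪ ⁅ w ⁆ → pair i ≡ (v , w)
  pair-determined i v<w eq =
    let _ , _ , v′∈e , w′∈e = originalEdge i
    in ordered-pair-unique v<w (proj₁ (pair-meets i))
         (subst (_ ∈_) eq v′∈e) (subst (_ ∈_) eq w′∈e)

  edge-toEdge : ∀ i → endpoints i ≡ edge (toEdge i)
  edge-toEdge i with v , w , v<w , eq ← ∣p∣≡2⇒p≡⁅x⁆∪⁅y⁆ _ (2-uniform (toEdge i)) =
    trans (cong (λ (v , w) → ⁅ v ⁆ ∪ ⁅ w ⁆) (pair-determined i v<w eq)) (sym eq)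

  pair-injective : ∀ i j → pair i ≡ pair j → i ≡ j
  pair-injective = lookup-injective
    (Unique.filter⁺ meet? (Unique.cartesianProduct⁺ (Unique.allFin⁺ n) (Unique.allFin⁺ n)))

  -- The edge of `G` recovers the pair, and the pair recovers the index because `meetingPairs` has
  -- no repetitions.
  toEdge-injective : ∀ {i j} → toEdge i ≡ toEdge j → i ≡ j
  toEdge-injective {i} {j} eq = pair-injective i j
    (pair-determined i (proj₁ (pair-meets j)) (trans (cong edge eq) (sym (edge-toEdge j))))

  toEdge-surjective : ∀ e → ∃[ i ] toEdge i ≡ e
  toEdge-surjective e with v , w , v<w , eq ← ∣p∣≡2⇒p≡⁅x⁆∪⁅y⁆ _ (2-uniform e) =
    -- The search behind `toEdge i` chooses its own common vertex. Linearity identifies the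
    -- resulting edge with `e`, as both contain `v` and `w`.
    i , edges-meet-once k linear (<⇒≢ v<w)
          (subst (λ (v , _) → v ∈ edge (toEdge i)) pair-i v′∈)
          (subst (λ (_ , w) → w ∈ edge (toEdge i)) pair-i w′∈)
          v∈e w∈e
    where
    v∈e : v ∈ edge e
    v∈e = subst (v ∈_) (sym eq) (x∈p∪q⁺ (inj₁ (x∈⁅x⁆ v)))
    w∈e : w ∈ edge e
    w∈e = subst (w ∈_) (sym eq) (x∈p∪q⁺ (inj₂ (x∈⁅x⁆ w)))
    vw∈pairs : (v , w) List.∈ meetingPairs
    vw∈pairs = ∈-filter⁺ meet? (∈-cartesianProduct⁺ (∈-allFin v) (∈-allFin w))
      -- The common vertex supplied here is `e` itself, as an old vertex of the dual.
      (v<w , _ , x∈p∩q⁺ (x∈p⇒x↑ˡ∈p++q (e∈edgesAt⁺ v∈e) , x∈p⇒x↑ˡ∈p++q (e∈edgesAt⁺ w∈e)))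
    i : Fin size
    i = index vw∈pairs
    pair-i : pair i ≡ (v , w)
    pair-i = sym (lookup-index vw∈pairs)
    v′∈ : proj₁ (pair i) ∈ edge (toEdge i)
    v′∈ = proj₁ (proj₂ (proj₂ (originalEdge i)))
    w′∈ : proj₂ (pair i) ∈ edge (toEdge i)
    w′∈ = proj₂ (proj₂ (proj₂ (originalEdge i)))

  Λ-paddedDual : Λ H (paddedDual-linear k linear) ≈ G
  Λ-paddedDual = record
    { rename          = ⤖⇒↔ (mk⤖ (toEdge-injective , strictlySurjective⇒surjective toEdge-surjective))
    ; sameVertices    = edge-toEdge
    -- The sign in `Λ H` branches on `splitAt m (common i)`, which `originalEdge` resolves to
    -- `inj₁ (toEdge i)`.
    ; sameOrientation = λ v i _ v∈e → trans
        (cong [ extendedσ v , const Sign.+ ]′ (proj₁ (proj₂ (originalEdge i))))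
        (extendedσ-σ v (toEdge i) v∈e)
    }

theorem3p5 : ∀ {n m : ℕ} (G : OrientedHypergraph n m) →
    OrientedHypergraph.Uniform G 2 →
    OrientedHypergraph.Linear G →
    ∀ (k : ℕ) → OrientedHypergraph.maxDegree G ≤ k →
    ∃[ N ] Σ[ H ∈ OrientedHypergraph N n ] Σ[ lin ∈ OrientedHypergraph.Linear H ]
      (OrientedHypergraph.Uniform H k × (Λ H lin ≈ G))
theorem3p5 G 2-uniform linear k Δ≤k =
  Dual.order hypergraph k , H G 2-uniform linear k , Dual.paddedDual-linear hypergraph k linear ,
  Dual.paddedDual-uniform hypergraph k Δ≤k , Λ-paddedDual G 2-uniform linear k
  where open OrientedHypergraph G
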